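{- Assume $I(\omega)$. Then for every model $\mathcal A$ of cardinality $\omega_1$ the following conditions are equivalent: (i) $\sigma(\mathcal A)>\omega_1$; (ii) $\sigma(\mathcal A)=2^{\omega_1}$; (iii) $\mathcal A$ is perfect.
   Context: $\sigma(\mathcal A)$ denotes the number of automorphisms of $\mathcal A$. Models are structures for a vocabulary of finitary symbols. $I(\omega)$ is the assumption: there is a (proper) ideal $I$ on $\omega_2$ which is $\omega_2$-complete (closed under unions of at most $\omega_1$ members), normal, contains all singletons $\{\alpha\}$, $\alpha<\omega_2$, and such that $I^+=\{X\subseteq\omega_2 : X\notin I\}$ has a dense subset $K$ (i.e. $K\subseteq I^+$ and every $X\in I^+$ includes some $Y\in K$) with the property that every descending (under inclusion) chain of length $<\omega_1$ of elements of $K$ has a lower bound in $K$. Perfect models: for a model $\mathcal A$ of cardinality $\omega_1$, the game $G(\mathcal A)$ has $\omega_1$ moves and two players $\exists$ and $\forall$. During the game a countable partial isomorphism $\pi$ from $\mathcal A$ to $\mathcal A$ (a partial map preserving and reflecting atomic formulas) is extended, starting from $\pi=\emptyset$ and taking unions at limits. At each move $\forall$ first plays a point $x$ of $\mathcal A$ and says whether $x$ is to be in the domain or in the range of the extension. Then $\exists$ must produce two contradictory countable partial isomorphisms $\pi',\pi''$ extending $\pi$, both having $x$ in the domain (respectively range); contradictory means that no partial isomorphism extends both $\pi'$ and $\pi''$. Then $\forall$ chooses one of $\pi',\pi''$ with which the game goes on. $\exists$ wins if he can play all $\omega_1$ moves. $\mathcal A$ is perfect if $\exists$ has a winning strategy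 in $G(\mathcal A)$. -}

module Defs where

open import Data.Bool using (Bool)
open import Data.Fin using (Fin)
open import Data.Nat using (ℕ)
open import Data.Product using (Σ-syntax; ∃-syntax; _×_; _,_; proj₁; proj₂)
open import Data.Vec using (Vec; []; _∷_; map; lookup)
open import Data.Vec.Relation.Binary.Pointwise.Inductive using (Pointwise)
open import Function.Bundles using (_⇔_; _↔_; Inverse; Injection)
open import Induction.WellFounded using (WellFounded)
open import Level using (Level; 0ℓ; _⊔_)
open import Relation.Binary using (Rel; Setoid; IsStrictTotalOrder; _⇒_)
open import Relation.Binary.PropositionalEquality
  using (_≡_; refl; sym; trans; _→-setoid_)
open import Relation.Nullary using (¬_)
open import Relation.Unary using (Pred; U; ∅; _∪_; ⋃; _⊆_; _∈_; _∉_; ｛_｝)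

------------------------------------------------------------------------
-- Cardinals

infix 4 _≺_ _≈ᶜ_ _EmbedsIn_
infix 8 2^_

private variable
  a b ℓ₁ ℓ₂ : Level

-- A set carries the cardinality of its quotient when it is given with an
-- equivalence relation, so that automorphisms and functions are counted
-- up to pointwise equality.

_≺_ : Setoid a ℓ₁ → Setoid b ℓ₂ → Set (a ⊔ b ⊔ ℓ₁ ⊔ ℓ₂)
X ≺ Y = Injection X Y × ¬ Injection Y X

_≈ᶜ_ : Setoid a ℓ₁ → Setoid b ℓ₂ → Set (a ⊔ b ⊔ ℓ₁ ⊔ ℓ₂)
X ≈ᶜ Y = Inverse X Y

-- The subset P of A has cardinality at most that of the inhabited set B;
-- values of the map outside P are irrelevant.

_EmbedsIn_ : {A : Set} → Pred A 0ℓ → Set → Set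
_EmbedsIn_ {A} P B =
  Σ[ f ∈ (A → B) ] (∀ {x y} → x ∈ P → y ∈ P → f x ≡ f y → x ≡ y)

-- The successor cardinal of B, as a well-ordered set: the least ordinal that
-- does not inject into B.  It is unique up to order isomorphism.  With
-- B = ℕ this is ω₁, and with B = ω₁ it is ω₂.

record SuccessorCardinal (B : Set) : Set₁ where
  field
    Carrier            : Set
    _<_                : Rel Carrier 0ℓ
    isStrictTotalOrder : IsStrictTotalOrder _≡_ _<_
    wellFounded        : WellFounded _<_
    segment-small      : ∀ α → (_< α) EmbedsIn B
    large              : ¬ (U {A = Carrier} EmbedsIn B)

open SuccessorCardinal public using () renaming (Carrier to ⌊_⌋)

-- 2^κ
2^_ : Set → Setoid 0ℓ 0ℓ
2^ κ = κ →-setoid Bool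

------------------------------------------------------------------------
-- The assumption I(ω)

Family : Set → Set₁
Family W = Pred (Pred W 0ℓ) 0ℓ

module _ (ω₁ : SuccessorCardinal ℕ) (ω₂ : SuccessorCardinal ⌊ ω₁ ⌋) where

  private
    module ω₁ = SuccessorCardinal ω₁
    module ω₂ = SuccessorCardinal ω₂

  record IsProperIdeal (I : Family ⌊ ω₂ ⌋) : Set₁ where
    field
      empty    : ∅ ∈ I
      downward : ∀ {X Y} → X ⊆ Y → Y ∈ I → X ∈ I
      union    : ∀ {X Y} → X ∈ I → Y ∈ I → (X ∪ Y) ∈ I
      proper   : U ∉ I

  -- Families indexed by ω₁, repetitions allowed, are exactly the nonempty
  -- families with at most ω₁ members.
  IsComplete : Family ⌊ ω₂ ⌋ → Set₁
  IsComplete I =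
    (X : ⌊ ω₁ ⌋ → Pred ⌊ ω₂ ⌋ 0ℓ) → (∀ i → X i ∈ I) → ⋃ ⌊ ω₁ ⌋ X ∈ I

  ∇ : (⌊ ω₂ ⌋ → Pred ⌊ ω₂ ⌋ 0ℓ) → Pred ⌊ ω₂ ⌋ 0ℓ
  ∇ X β = ∃[ α ] (α ω₂.< β × β ∈ X α)

  -- Closure under diagonal unions.
  IsNormal : Family ⌊ ω₂ ⌋ → Set₁
  IsNormal I = (X : ⌊ ω₂ ⌋ → Pred ⌊ ω₂ ⌋ 0ℓ) → (∀ α → X α ∈ I) → ∇ X ∈ I

  -- K is a dense subset of I⁺.
  IsDense : Family ⌊ ω₂ ⌋ → Family ⌊ ω₂ ⌋ → Set₁
  IsDense I K =
    (∀ {X} → X ∈ K → X ∉ I) ×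
    (∀ X → X ∉ I → ∃[ Y ] (Y ∈ K × Y ⊆ X))

  -- Lengths below ω₁ are the elements δ of ω₁; the members of the chain are
  -- the Y ξ with ξ < δ, and the other values of Y are irrelevant.
  IsClosed : Family ⌊ ω₂ ⌋ → Set₁
  IsClosed K =
    (δ : ⌊ ω₁ ⌋) (Y : ⌊ ω₁ ⌋ → Pred ⌊ ω₂ ⌋ 0ℓ) →
    (∀ ξ → ξ ω₁.< δ → Y ξ ∈ K) →
    (∀ ξ η → ξ ω₁.< η → η ω₁.< δ → Y η ⊆ Y ξ) →
    ∃[ Z ] (Z ∈ K × (∀ ξ → ξ ω₁.< δ → Z ⊆ Y ξ))

  record I⟨ω⟩ : Set₁ where
    field
      I             : Family ⌊ ω₂ ⌋
      isProperIdeal : IsProperIdeal I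
      isComplete    : IsComplete I
      isNormal      : IsNormal I
      singletons    : ∀ α → ｛ α ｝ ∈ I
      K             : Family ⌊ ω₂ ⌋
      isDense       : IsDense I K
      isClosed      : IsClosed K

------------------------------------------------------------------------
-- Models

record Vocabulary : Set₁ where
  field
    RelSym   : Set
    relArity : RelSym → ℕ
    FunSym   : Set
    funArity : FunSym → ℕ

-- Constants are function symbols of arity 0.
record Model (L : Vocabulary) : Set₁ where
  open Vocabulary L
  field
    ∣_∣    : Set
    rel⟦_⟧ : (R : RelSym) → Pred (Vec ∣_∣ (relArity R)) 0ℓ
    fun⟦_⟧ : (f : FunSym) → Vec ∣_∣ (funArity f) → ∣_∣

open Model public using (∣_∣)

module _ (L : Vocabulary) where
  open Vocabulary L

  data Term (n : ℕ) : Set where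
    var : Fin n → Term n
    app : (f : FunSym) → Vec (Term n) (funArity f) → Term n

  data Atomic (n : ℕ) : Set where
    equal : Term n → Term n → Atomic n
    rel   : (R : RelSym) → Vec (Term n) (relArity R) → Atomic n

module _ {L : Vocabulary} (𝒜 : Model L) where
  open Vocabulary L
  open Model 𝒜 using (rel⟦_⟧; fun⟦_⟧)

  private
    A : Set
    A = ∣ 𝒜 ∣

  mutual
    eval : ∀ {n} → Vec A n → Term L n → A
    eval ρ (var i)    = lookup ρ i
    eval ρ (app f ts) = fun⟦ f ⟧ (evals ρ ts)

    evals : ∀ {n k} → Vec A n → Vec (Term L n) k → Vec A k
    evals ρ []       = []
    evals ρ (t ∷ ts) = eval ρ t ∷ evals ρ ts

  _⊨_ : ∀ {n} → Vec A n → Atomic L n → Set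
  ρ ⊨ equal s t = eval ρ s ≡ eval ρ t
  ρ ⊨ rel R ts  = rel⟦ R ⟧ (evals ρ ts)

  ----------------------------------------------------------------------
  -- Automorphisms

  record Automorphism : Set where
    field
      bijection : A ↔ A
    open Inverse bijection public using (to)
    field
      preserves-fun : ∀ f v → to (fun⟦ f ⟧ v) ≡ fun⟦ f ⟧ (map to v)
      preserves-rel : ∀ R v → rel⟦ R ⟧ v ⇔ rel⟦ R ⟧ (map to v)

  -- σ 𝒜 : automorphisms are equal when their underlying maps are.
  σ : Setoid 0ℓ 0ℓ
  σ = record
    { Carrier       = Automorphism
    ; _≈_           = λ g h → ∀ x → Automorphism.to g x ≡ Automorphism.to h x
    ; isEquivalence = record
      { refl  = λ _ → refl
      ; sym   = λ p x → sym (p x)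
      ; trans = λ p q x → trans (p x) (q x)
      }
    }

  ----------------------------------------------------------------------
  -- Partial isomorphisms

  -- Partial maps are given by their graphs.
  record IsPartialIso (π : Rel A 0ℓ) : Set where
    field
      functional : ∀ {x y z} → π x y → π x z → y ≡ z
      atomic     : ∀ {n} {u v : Vec A n} → Pointwise π u v →
                   (φ : Atomic L n) → (u ⊨ φ) ⇔ (v ⊨ φ)

  IsCountable : Rel A 0ℓ → Set
  IsCountable π = (λ x → ∃[ y ] π x y) EmbedsIn ℕ

  Contradictory : Rel A 0ℓ → Rel A 0ℓ → Set₁
  Contradictory π′ π″ = ¬ (∃[ ρ ] (IsPartialIso ρ × π′ ⇒ ρ × π″ ⇒ ρ))

  ----------------------------------------------------------------------
  -- The game G(𝒜)

  data Side : Set where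
    domain range : Side

  Challenge : Set
  Challenge = A × Side

  Meets : Challenge → Rel A 0ℓ → Set
  Meets (x , domain) π = ∃[ y ] π x y
  Meets (x , range)  π = ∃[ y ] π y x

  data Choice : Set where
    first second : Choice

  pick : Choice → Rel A 0ℓ × Rel A 0ℓ → Rel A 0ℓ
  pick first  = proj₁
  pick second = proj₂

  IsOption : Rel A 0ℓ → Challenge → Rel A 0ℓ → Set
  IsOption π c π′ = IsPartialIso π′ × IsCountable π′ × π ⇒ π′ × Meets c π′

  -- Legality of the answer of ∃ to the challenge c at the position π.
  IsLegal : Rel A 0ℓ → Challenge → Rel A 0ℓ × Rel A 0ℓ → Set₁
  IsLegal π c (π′ , π″) =
    IsOption π c π′ × IsOption π c π″ × Contradictory π′ π″

  -- What ∀ does in one move: a challenge, and a choice between the answers.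
  Turn : Set
  Turn = Challenge × Choice

  module _ (ω₁ : SuccessorCardinal ℕ) where
    open SuccessorCardinal ω₁ using (_<_)

    -- At move α, ∃ knows the turns of ∀ before α and the challenge at α.
    Strategy : Set₁
    Strategy = (α : ⌊ ω₁ ⌋) → (∀ β → β < α → Turn) → Challenge →
               Rel A 0ℓ × Rel A 0ℓ

    -- The play in which ∃ uses τ and the turns of ∀ are given by t.
    module _ (τ : Strategy) (t : ⌊ ω₁ ⌋ → Turn) where

      answer : ⌊ ω₁ ⌋ → Rel A 0ℓ × Rel A 0ℓ
      answer α = τ α (λ β _ → t β) (proj₁ (t α))

      chosen : ⌊ ω₁ ⌋ → Rel A 0ℓ
      chosen α = pick (proj₂ (t α)) (answer α)

      -- The position before move α.  Since legal answers extend the position,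
      -- this union is the map chosen last when α is a successor, and it
      -- is empty when α is least.
      position : ⌊ ω₁ ⌋ → Rel A 0ℓ
      position α x y = ∃[ β ] (β < α × chosen β x y)

    IsWinning : Strategy → Set₁
    IsWinning τ = ∀ t α → IsLegal (position τ t α) (proj₁ (t α)) (answer τ t α)

    Perfect : Set₁
    Perfect = ∃[ τ ] IsWinning τ

{-# OPTIONS --safe #-}
module Submission where

-- (i) ⇒ (iii).  A model with more than ω₁ automorphisms has pairwise distinct
-- automorphisms g γ, γ < ω₂.  Besides the position π, ∃ keeps a set X ∈ K such
-- that g γ extends π for all γ ∈ X.  For any X ∉ I and any point, one of the ω₁
-- possible values at that point is taken by g γ for a set of γ ∈ X outside I, and
-- at some point two values are; otherwise, by completeness of I, the g γ would
-- agree for I-almost all γ ∈ X.  So ∃ can meet every challenge and branch, and K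
-- being closed carries him through the limits.
--
-- (iii) ⇒ (ii).  If ∀ runs through all challenges in a fixed order, the union of
-- the positions is an automorphism, and different sequences of choices yield
-- different automorphisms.  Conversely an automorphism is a subset of ω₁ × ω₁, so
-- the Cantor–Bernstein theorem applies.  (ii) ⇒ (i) is Cantor's theorem.

open import Axiom.DoubleNegationElimination using (em⇒dne)
open import Axiom.ExcludedMiddle using (ExcludedMiddle)
open import Axiom.Extensionality.Propositional
  using (Extensionality; implicit-extensionality)
open import Data.Bool using (Bool; true; false)
open import Data.Empty using (⊥-elim)
open import Data.Fin using (Fin; zero; suc)
open import Data.Nat using (ℕ; _+_; _*_; zero; suc)
import Data.Nat as ℕ
import Data.Nat.Induction as ℕ
import Data.Nat.Properties as ℕ
open import Data.Product
  using (Σ-syntax; ∃-syntax; _×_; _,_; proj₁; proj₂; uncurry; map₂)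
open import Data.Product.Relation.Binary.Lex.Strict using (×-Lex; ×-compare; ×-wellFounded)
open import Data.Product.Relation.Binary.Pointwise.NonDependent using (≡×≡⇒≡; ≡⇒≡×≡)
open import Data.Sum using (_⊎_; inj₁; inj₂)
open import Data.Unit using (tt)
open import Data.Vec using (Vec; []; _∷_; map; lookup; tabulate)
open import Data.Vec.Properties using (lookup-map; tabulate∘lookup)
open import Data.Vec.Relation.Binary.Pointwise.Inductive as Pointwise
  using (Pointwise; []; _∷_)
open import Function using (_∘_; id)
open import Function.Bundles
  using (_⇔_; _↔_; mk⇔; mk↔ₛ′; Inverse; Injection; Equivalence)
open import Function.Construct.Composition using (injection)
open import Function.Properties.Bijection using (Bijection⇒Inverse)
open import Function.Properties.Inverse using (Inverse⇒Injection) renaming (sym to ≈ᶜ-sym)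
open import Induction.WellFounded as WF using (WellFounded; module FixPoint)
open import Level using (0ℓ)
open import Relation.Binary
  using (Rel; Setoid; Trichotomous; IsStrictTotalOrder; tri<; tri≈; tri>; _⇒_)
open import Relation.Binary.PropositionalEquality
  using (_≡_; _≢_; refl; sym; trans; cong; cong₂; subst; subst₂; setoid)
open import Relation.Nullary using (¬_; Dec; yes; no; does; contradiction)
open import Relation.Unary using (Pred; U; ∅; _∪_; ⋃; _⊆_; _∈_; _∉_; ｛_｝)
open import Defs

-- Embeddings and a pairing function on the natural numbers.

Countable : {A : Set} → Pred A 0ℓ → Set
Countable P = P EmbedsIn ℕ

EmbedsIn-pullback : {A A′ B : Set} {P : Pred A 0ℓ} {Q : Pred A′ 0ℓ} (f : A′ → A) →
  (∀ {x} → x ∈ Q → f x ∈ P) →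
  (∀ {x y} → x ∈ Q → y ∈ Q → f x ≡ f y → x ≡ y) →
  P EmbedsIn B → Q EmbedsIn B
EmbedsIn-pullback f Q⇒P inj (e , e-inj) =
  e ∘ f , λ p q eq → inj p q (e-inj (Q⇒P p) (Q⇒P q) eq)

EmbedsIn-⊆ : {A B : Set} {P Q : Pred A 0ℓ} → Q ⊆ P → P EmbedsIn B → Q EmbedsIn B
EmbedsIn-⊆ Q⊆P = EmbedsIn-pullback id Q⊆P (λ _ _ → id)

-- A variant of Cantor's pairing that avoids halving. It is not onto, but coding needs only
-- injectivity.
pair : ℕ → ℕ → ℕ
pair m n = (m + n) * (m + n) + m

-- pair m n lies in the interval from s² to (s + 1)² − 1, where s = m + n.
pair-mono-< : ∀ {m n m′ n′} → m + n ℕ.< m′ + n′ → pair m n ℕ.< pair m′ n′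
pair-mono-< {m} {n} {m′} {n′} s<s′ = begin-strict
  s * s + m        ≤⟨ ℕ.+-monoʳ-≤ (s * s) (ℕ.m≤m+n m n) ⟩
  s * s + s        ≡⟨ ℕ.+-comm (s * s) s ⟩
  s + s * s        ≡⟨ ℕ.*-suc s s ⟨
  s * suc s        <⟨ ℕ.m<n+m (s * suc s) ℕ.z<s ⟩
  suc s * suc s    ≤⟨ ℕ.*-mono-≤ s<s′ s<s′ ⟩
  s′ * s′          ≤⟨ ℕ.m≤m+n (s′ * s′) m′ ⟩
  s′ * s′ + m′     ∎
  where
  open ℕ.≤-Reasoning
  s s′ : ℕ
  s  = m + n
  s′ = m′ + n′

pair-injective : ∀ {m n m′ n′} → pair m n ≡ pair m′ n′ → m ≡ m′ × n ≡ n′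
pair-injective {m} {n} {m′} {n′} eq with ℕ.<-cmp (m + n) (m′ + n′)
... | tri< s<s′ _ _ = contradiction eq (ℕ.<⇒≢ (pair-mono-< {m} {n} {m′} {n′} s<s′))
... | tri> _ _ s′<s =
  contradiction (sym eq) (ℕ.<⇒≢ (pair-mono-< {m′} {n′} {m} {n} s′<s))
... | tri≈ _ s≡s′ _ = m≡m′ , ℕ.+-cancelˡ-≡ m n n′ (trans s≡s′ (cong (_+ n′) (sym m≡m′)))
  where
  m≡m′ : m ≡ m′
  m≡m′ = ℕ.+-cancelˡ-≡ ((m + n) * (m + n)) m m′
    (trans eq (cong (λ s → s * s + m′) (sym s≡s′)))

module _ {X Y : Setoid 0ℓ 0ℓ} (F : Injection X Y) (G : Injection Y X) where
  private
    module X = Setoid X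
    module Y = Setoid Y
    module F = Injection F
    module G = Injection G

  -- The points whose backward orbit under F and G stops in X.
  data StopsInDomain : X.Carrier → Set where
    stop : ∀ {x} → (∀ y → ¬ G.to y X.≈ x) → StopsInDomain x
    step : ∀ {x x′} → StopsInDomain x → G.to (F.to x) X.≈ x′ → StopsInDomain x′

-- Automorphisms as total and onto partial isomorphisms.

module _ {L : Vocabulary} (𝒜 : Model L) where
  open Vocabulary L
  open Model 𝒜 using (rel⟦_⟧; fun⟦_⟧)
  open Automorphism using (to; bijection; preserves-fun; preserves-rel)

  private
    A : Set
    A = ∣ 𝒜 ∣

    Aut : Set
    Aut = Automorphism 𝒜

  graph : Aut → Rel A 0ℓ
  graph g x y = to g x ≡ y

  restriction : {π ρ : Rel A 0ℓ} → π ⇒ ρ → IsPartialIso 𝒜 ρ → IsPartialIso 𝒜 π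
  restriction π⇒ρ iso = record
    { functional = λ p q → functional (π⇒ρ p) (π⇒ρ q)
    ; atomic     = atomic ∘ Pointwise.map π⇒ρ
    }
    where open IsPartialIso iso

  -- Equality of two variables is an atomic formula, and atomic formulas are reflected.
  partialIso-injective : {π : Rel A 0ℓ} → IsPartialIso 𝒜 π → ∀ {x y z} → π x z → π y z → x ≡ y
  partialIso-injective iso p q =
    Equivalence.from
      (IsPartialIso.atomic iso (p ∷ q ∷ []) (equal (var zero) (var (suc zero)))) refl

  -- Serves to read off symbols from atomic formulas in which they are applied to variables. The
  -- reindexing `i` lets variable 0 be set aside for the value of a function.
  evals-variables : ∀ {m} (ρ : Vec A m) {n} (i : Fin n → Fin m) →
    evals 𝒜 ρ (tabulate (var ∘ i)) ≡ tabulate (lookup ρ ∘ i)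
  evals-variables ρ {zero}  i = refl
  evals-variables ρ {suc n} i = cong (lookup ρ (i zero) ∷_) (evals-variables ρ (i ∘ suc))

  module _ (g : Aut) where

    to-injective : ∀ {x y} → to g x ≡ to g y → x ≡ y
    to-injective = Injection.injective (Inverse⇒Injection (bijection g))

    to-eval : ∀ {n} (ρ : Vec A n) (t : Term L n) →
      to g (eval 𝒜 ρ t) ≡ eval 𝒜 (map (to g) ρ) t
    to-evals : ∀ {n k} (ρ : Vec A n) (ts : Vec (Term L n) k) →
      map (to g) (evals 𝒜 ρ ts) ≡ evals 𝒜 (map (to g) ρ) ts
    to-eval ρ (var i)    = sym (lookup-map i (to g) ρ)
    to-eval ρ (app f ts) = trans (preserves-fun g f _) (cong fun⟦ f ⟧ (to-evals ρ ts))
    to-evals ρ []       = refl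
    to-evals ρ (t ∷ ts) = cong₂ _∷_ (to-eval ρ t) (to-evals ρ ts)

    graph⇒map : ∀ {n} {u v : Vec A n} → Pointwise (graph g) u v → map (to g) u ≡ v
    graph⇒map []       = refl
    graph⇒map (p ∷ ps) = cong₂ _∷_ p (graph⇒map ps)

    graph-isPartialIso : IsPartialIso 𝒜 (graph g)
    graph-isPartialIso = record
      { functional = λ { refl refl → refl }
      ; atomic     = λ {n} {u} ps φ →
          subst (λ v → _⊨_ 𝒜 u φ ⇔ _⊨_ 𝒜 v φ) (graph⇒map ps) (preserved u φ)
      }
      where
      preserved : ∀ {n} (u : Vec A n) (φ : Atomic L n) →
        _⊨_ 𝒜 u φ ⇔ _⊨_ 𝒜 (map (to g) u) φ
      preserved u (equal s t) = mk⇔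
        (λ eq → trans (sym (to-eval u s)) (trans (cong (to g) eq) (to-eval u t)))
        (λ eq → to-injective (trans (to-eval u s) (trans eq (sym (to-eval u t)))))
      preserved u (rel R ts) =
        subst (λ v → rel⟦ R ⟧ (evals 𝒜 u ts) ⇔ rel⟦ R ⟧ v) (to-evals u ts)
          (preserves-rel g R (evals 𝒜 u ts))

  -- Atomic formulas have finitely many variables, so their preservation is
  -- decided inside a single member of the family.
  module _ {J : Set} (j₀ : J) (π : J → Rel A 0ℓ)
    (directed : ∀ i j → ∃[ k ] (π i ⇒ π k × π j ⇒ π k))
    (iso : ∀ j → IsPartialIso 𝒜 (π j))
    where

    ⋃-rel : Rel A 0ℓ
    ⋃-rel x y = ∃[ j ] π j x y

    single-member : ∀ {n} {u v : Vec A n} → Pointwise ⋃-rel u v → ∃[ j ] Pointwise (π j) u v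
    single-member []             = j₀ , []
    single-member ((i , p) ∷ ps) =
      let j , qs        = single-member ps
          k , i⇒k , j⇒k = directed i j
      in k , i⇒k p ∷ Pointwise.map j⇒k qs

    ⋃-isPartialIso : IsPartialIso 𝒜 ⋃-rel
    ⋃-isPartialIso = record
      { functional = λ (i , p) (j , q) →
          let k , i⇒k , j⇒k = directed i j
          in IsPartialIso.functional (iso k) (i⇒k p) (j⇒k q)
      ; atomic = λ ps φ →
          let j , qs = single-member ps in IsPartialIso.atomic (iso j) qs φ
      }

  module _ {ρ : Rel A 0ℓ} (iso : IsPartialIso 𝒜 ρ)
    (total : ∀ x → ∃[ y ] ρ x y) (onto : ∀ y → ∃[ x ] ρ x y)
    where
    open IsPartialIso iso

    private
      f : A → A
      f = proj₁ ∘ total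

      along : ∀ {n} (v : Vec A n) → Pointwise ρ v (map f v)
      along []      = []
      along (x ∷ v) = proj₂ (total x) ∷ along v

      variables : ∀ {n} (v : Vec A n) → evals 𝒜 v (tabulate var) ≡ v
      variables v = trans (evals-variables v id) (tabulate∘lookup v)

      variables′ : ∀ {n} x (v : Vec A n) → evals 𝒜 (x ∷ v) (tabulate (var ∘ suc)) ≡ v
      variables′ x v = trans (evals-variables (x ∷ v) suc) (tabulate∘lookup v)

    automorphism : Aut
    automorphism = record
      { bijection     = mk↔ₛ′ f (proj₁ ∘ onto)
          (λ y → functional (proj₂ (total _)) (proj₂ (onto y)))
          (λ x → partialIso-injective iso (proj₂ (onto _)) (proj₂ (total x)))
      -- The tuple `fun⟦ F ⟧ v ∷ v` satisfies the formula v₀ = F(v₁, ..., vₙ), hence so does its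
      -- image under `f`.
      ; preserves-fun = λ F v →
          trans (Equivalence.to (atomic (along (fun⟦ F ⟧ v ∷ v))
                   (equal (var zero) (app F (tabulate (var ∘ suc)))))
                   (cong fun⟦ F ⟧ (sym (variables′ _ v))))
                (cong fun⟦ F ⟧ (variables′ _ (map f v)))
      ; preserves-rel = λ R v → subst₂ (λ u w → rel⟦ R ⟧ u ⇔ rel⟦ R ⟧ w)
          (variables v) (variables (map f v)) (atomic (along v) (rel R (tabulate var)))
      }

    ⊆-automorphism : ρ ⇒ graph automorphism
    ⊆-automorphism p = functional (proj₂ (total _)) p

  pick-option : ∀ ch {π c r} → IsLegal 𝒜 π c r → IsOption 𝒜 π c (pick 𝒜 ch r)
  pick-option first  = proj₁
  pick-option second = proj₁ ∘ proj₂

-- Countable unions and transfinite recursion.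

module _ (em : ∀ {ℓ} → ExcludedMiddle ℓ) (ext : ∀ {a b} → Extensionality a b) where

  private
    dne : ∀ {ℓ} {P : Set ℓ} → ¬ ¬ P → P
    dne = em⇒dne em

  insert-countable : {A : Set} {P : Pred A 0ℓ} (a : A) →
    Countable P → Countable (λ x → x ∈ P ⊎ x ≡ a)
  insert-countable {A} {P} a (e , e-inj) =
    (λ x → code x em) , λ p q → code-inj em em p q
    where
    code : ∀ x → Dec (x ≡ a) → ℕ
    code x (yes _) = 0
    code x (no _)  = suc (e x)

    member : ∀ {x} → x ≢ a → x ∈ P ⊎ x ≡ a → x ∈ P
    member x≢a (inj₁ p)   = p
    member x≢a (inj₂ x≡a) = contradiction x≡a x≢a

    code-inj : ∀ {x y} (d : Dec (x ≡ a)) (d′ : Dec (y ≡ a)) →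
      x ∈ P ⊎ x ≡ a → y ∈ P ⊎ y ≡ a → code x d ≡ code y d′ → x ≡ y
    code-inj (yes refl) (yes refl) _ _ _  = refl
    code-inj (no x≢a)   (no y≢a)   p q eq =
      e-inj (member x≢a p) (member y≢a q) (ℕ.suc-injective eq)

  -- Deciding membership with `em` fixes one index for each `x` before any proof of membership is
  -- given, so the pair of that index and the number of `x` in its fibre is a function of `x` alone.
  ⋃-countable : {A J : Set} {Q : Pred J 0ℓ} {P : J → Pred A 0ℓ} →
    Countable Q → (∀ {j} → j ∈ Q → Countable (P j)) →
    Countable (λ x → ∃[ j ] (j ∈ Q × x ∈ P j))
  ⋃-countable {A} {J} {Q} {P} (e , e-inj) c = (λ x → code em) , λ {x} p q → code-inj em em p q
    where
    -- The enumeration of P j must not depend on the proof of j ∈ Q.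
    fibre : ∀ j → Countable (λ x → j ∈ Q × x ∈ P j)
    fibre j with em {P = j ∈ Q}
    ... | yes q = EmbedsIn-⊆ proj₂ (c q)
    ... | no ¬q = (λ _ → 0) , λ (q , _) → contradiction q ¬q

    code : ∀ {x} → Dec (∃[ j ] (j ∈ Q × x ∈ P j)) → ℕ
    code {x} (yes (j , _)) = pair (e j) (proj₁ (fibre j) x)
    code     (no _)        = 0

    code-inj : ∀ {x y} (d : Dec (∃[ j ] (j ∈ Q × x ∈ P j)))
      (d′ : Dec (∃[ j ] (j ∈ Q × y ∈ P j))) →
      ∃[ j ] (j ∈ Q × x ∈ P j) → ∃[ j ] (j ∈ Q × y ∈ P j) → code d ≡ code d′ → x ≡ y
    code-inj (no ¬p) _ p _ _ = contradiction p ¬p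
    code-inj (yes _) (no ¬q) _ q _ = contradiction q ¬q
    code-inj {x} {y} (yes (j , q , p)) (yes (j′ , q′ , p′)) _ _ eq
      with i≡ , x≡ ← pair-injective {e j} {proj₁ (fibre j) x} {e j′} {proj₁ (fibre j′) y} eq
      with refl ← e-inj q q′ i≡ = proj₂ (fibre j) (q , p) (q′ , p′) x≡

  -- Transfinite construction with a specification that mentions the earlier values. The unfolding
  -- equation turns the history handed to `choose` into the values of the finished `f`;
  -- extensionality is what makes the recursion unfold.
  wf-choice : ∀ {p s} {X : Set} {_⊏_ : Rel X 0ℓ} → WellFounded _⊏_ →
    (P : X → Set p) (S : ∀ x → (∀ {y} → y ⊏ x → P y) → P x → Set s) →
    (∀ x (h : ∀ {y} → y ⊏ x → P y) → ∃[ v ] S x h v) →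
    Σ[ f ∈ (∀ x → P x) ] (∀ x → S x (λ {y} _ → f y) (f x))
  wf-choice {p} {X = X} {_⊏_} wf P S choose = f , λ x →
    subst (S x (λ {y} _ → f y)) (sym unfold-wfRec) (proj₂ (choose x (λ {y} _ → f y)))
    where
    body : ∀ x → (∀ {y} → y ⊏ x → P y) → P x
    body x h = proj₁ (choose x h)

    f : ∀ x → P x
    f = WF.All.wfRec wf p P body

    body-ext : ∀ x {h h′ : ∀ {y} → y ⊏ x → P y} →
      (∀ {y} (y⊏x : y ⊏ x) → h y⊏x ≡ h′ y⊏x) → body x h ≡ body x h′
    body-ext x eq = cong (λ (h : ∀ {y} → y ⊏ x → P y) → body x h)
      (implicit-extensionality ext (ext eq))

    open FixPoint wf P body body-ext using (unfold-wfRec)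

  -- The values of f outside the segment below x are junk.
  greedy : {X Y : Set} {_⊏_ : Rel X 0ℓ} → WellFounded _⊏_ →
    (R : Rel Y 0ℓ) → Y →
    (∀ x (f : X → Y) → ∃[ v ] (∀ y → y ⊏ x → R (f y) v)) →
    Σ[ f ∈ (X → Y) ] (∀ {y x} → y ⊏ x → R (f y) (f x))
  greedy {X} {Y} {_⊏_} wf R y₀ fresh =
    map₂ (λ {f} s {y} {x} y⊏x → subst (λ v → R v (f x)) (extend-≡ f em y⊏x) (s x y y⊏x))
      (wf-choice wf (λ _ → Y) (λ x h v → ∀ y → y ⊏ x → R (extend h y em) v)
        (λ x h → fresh x (λ y → extend h y em)))
    where
    extend : ∀ {x} → (∀ {y} → y ⊏ x → Y) → ∀ y → Dec (y ⊏ x) → Y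
    extend h y (yes y⊏x) = h y⊏x
    extend h y (no _)    = y₀

    extend-≡ : ∀ (f : X → Y) {x y} (d : Dec (y ⊏ x)) → y ⊏ x →
      extend (λ {z} _ → f z) y d ≡ f y
    extend-≡ f (yes _)  _   = refl
    extend-≡ f (no y⊏̸x) y⊏x = contradiction y⊏x y⊏̸x

  distinct-injective : {X Y : Set} {_⊏_ : Rel X 0ℓ} {_≈_ : Rel Y 0ℓ} →
    (∀ {u v} → u ≈ v → v ≈ u) → Trichotomous _≡_ _⊏_ →
    (f : X → Y) → (∀ {y x} → y ⊏ x → ¬ f y ≈ f x) →
    ∀ {x y} → f x ≈ f y → x ≡ y
  distinct-injective ≈-sym cmp f distinct {x} {y} eq with cmp x y
  ... | tri< x⊏y _ _ = contradiction eq (distinct x⊏y)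
  ... | tri≈ _ x≡y _ = x≡y
  ... | tri> _ _ y⊏x = contradiction (≈-sym eq) (distinct y⊏x)

  -- Power sets, Cantor's theorem and the Cantor-Bernstein theorem.

  indicator : {A : Set} → Pred A 0ℓ → A → Bool
  indicator P x = does (em {P = P x})

  indicator-true : {A : Set} {P : Pred A 0ℓ} {x : A} → x ∈ P → indicator P x ≡ true
  indicator-true {P = P} {x} p with em {P = P x}
  ... | yes _ = refl
  ... | no ¬p = contradiction p ¬p

  indicator-sound : {A : Set} {P : Pred A 0ℓ} {x : A} → indicator P x ≡ true → x ∈ P
  indicator-sound {P = P} {x} eq with em {P = P x}
  ... | yes p = p

  indicator-cong : {A : Set} {P Q : Pred A 0ℓ} {x : A} →
    (P x → Q x) → (Q x → P x) → indicator P x ≡ indicator Q x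
  indicator-cong {P = P} {Q} {x} to from with em {P = P x} | em {P = Q x}
  ... | yes _ | yes _ = refl
  ... | no _  | no _  = refl
  ... | yes p | no ¬q = contradiction (to p) ¬q
  ... | no ¬p | yes q = contradiction (from q) ¬p

  singleton-injection : {κ : Set} → Injection (setoid κ) (2^ κ)
  singleton-injection {κ} = record
    { to        = λ ξ → indicator ｛ ξ ｝
    ; cong      = λ { refl _ → refl }
    ; injective = λ {ξ} {η} eq →
        sym (indicator-sound {P = ｛ η ｝} (trans (sym (eq ξ)) (indicator-true {P = ｛ ξ ｝} refl)))
    }

  -- `D` collects the codes of functions that are not true at their own code. As `h` is injective,
  -- only the indicator of `D` has the code `δ`, so `δ` would lie in `D` exactly when it does not.
  cantor : {κ : Set} → ¬ Injection (2^ κ) (setoid κ)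
  cantor {κ} J = ∉D ∈D
    where
    open Injection J renaming (to to h; injective to h-inj)

    D : Pred κ 0ℓ
    D ξ = ∃[ f ] (h f ≡ ξ × f ξ ≢ true)

    δ : κ
    δ = h (indicator D)

    ∉D : ¬ δ ∈ D
    ∉D δ∈D@(f , eq , f≢) = f≢ (trans (h-inj eq δ) (indicator-true {P = D} δ∈D))

    ∈D : δ ∈ D
    ∈D = indicator D , refl , λ eq → ∉D (indicator-sound {P = D} eq)

  -- Points whose backward orbit stops in `X` are moved by `F`, all others by the inverse of `G`,
  -- which is defined there because a point outside the range of `G` stops at once. Working with the
  -- relation `_↦_` spares any canonical choice of representatives.
  cantor-bernstein : {X Y : Setoid 0ℓ 0ℓ} → Injection X Y → Injection Y X → Inverse X Y
  cantor-bernstein {X} {Y} F G = Bijection⇒Inverse (record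
    { to        = λ x → proj₁ (image x)
    ; cong      = λ {x} {x′} → functional (proj₂ (image x)) (proj₂ (image x′))
    ; bijective = (λ {x} {x′} → injective′ (proj₂ (image x)) (proj₂ (image x′)))
                , λ y → proj₁ (preimage y) ,
                    λ {x} eq → functional (proj₂ (image x)) (proj₂ (preimage y)) eq
    })
    where
    module X = Setoid X
    module Y = Setoid Y
    module F = Injection F
    module G = Injection G

    S : X.Carrier → Set
    S = StopsInDomain F G

    _↦_ : X.Carrier → Y.Carrier → Set
    x ↦ y = (S x × F.to x Y.≈ y) ⊎ (¬ S x × G.to y X.≈ x)

    resp : ∀ {x x′} → x X.≈ x′ → S x → S x′
    resp x≈x′ (stop out)  = stop (λ y eq → out y (X.trans eq (X.sym x≈x′)))
    resp x≈x′ (step s eq) = step s (X.trans eq x≈x′)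

    image : ∀ x → ∃[ y ] x ↦ y
    image x with em {P = S x}
    ... | yes s = F.to x , inj₁ (s , Y.refl)
    ... | no ¬s with em {P = ∃[ y ] G.to y X.≈ x}
    ...   | yes (y , eq) = y , inj₂ (¬s , eq)
    ...   | no none      = contradiction (stop (λ y eq → none (y , eq))) ¬s

    preimage : ∀ y → ∃[ x ] x ↦ y
    preimage y with em {P = S (G.to y)}
    ... | no ¬s                     = G.to y , inj₂ (¬s , X.refl)
    ... | yes (stop out)            = contradiction X.refl (out y)
    ... | yes (step {x = x} s eq)   = x , inj₁ (s , G.injective eq)

    functional : ∀ {x x′ y y′} → x ↦ y → x′ ↦ y′ → x X.≈ x′ → y Y.≈ y′
    functional (inj₁ (_ , p)) (inj₁ (_ , q)) eq =
      Y.trans (Y.sym p) (Y.trans (F.cong eq) q)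
    functional (inj₁ (s , _)) (inj₂ (¬s , _)) eq = contradiction (resp eq s) ¬s
    functional (inj₂ (¬s , _)) (inj₁ (s , _)) eq = contradiction (resp (X.sym eq) s) ¬s
    functional (inj₂ (_ , p)) (inj₂ (_ , q)) eq =
      G.injective (X.trans p (X.trans eq (X.sym q)))

    collide : ∀ {x x′ y y′} → F.to x Y.≈ y → G.to y′ X.≈ x′ → y Y.≈ y′ → S x → S x′
    collide p q eq s = step s (X.trans (G.cong (Y.trans p eq)) q)

    injective′ : ∀ {x x′ y y′} → x ↦ y → x′ ↦ y′ → y Y.≈ y′ → x X.≈ x′
    injective′ (inj₁ (_ , p)) (inj₁ (_ , q)) eq =
      F.injective (Y.trans p (Y.trans eq (Y.sym q)))
    injective′ (inj₁ (s , p)) (inj₂ (¬s , q)) eq = contradiction (collide p q eq s) ¬s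
    injective′ (inj₂ (¬s , q)) (inj₁ (s , p)) eq =
      contradiction (collide p q (Y.sym eq) s) ¬s
    injective′ (inj₂ (_ , p)) (inj₂ (_ , q)) eq =
      X.trans (X.sym p) (X.trans (G.cong eq) q)

  -- Cardinal arithmetic of ω₁.

  module _ (ω₁ : SuccessorCardinal ℕ) where
    open SuccessorCardinal ω₁
    open IsStrictTotalOrder isStrictTotalOrder using (compare)

    -- With at most one point, ω₁ would embed in `ℕ` by a constant map.
    another : ∀ α → ∃[ β ] β ≢ α
    another α = dne λ none → large
      ((λ _ → 0) , λ {x} {y} _ _ _ →
        trans (dne (λ x≢α → none (x , x≢α))) (sym (dne (λ y≢α → none (y , y≢α)))))

    inhabitant : ⌊ ω₁ ⌋
    inhabitant = dne λ none → large ((λ _ → 0) , λ {x} _ _ _ → contradiction x none)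

    segment-embedding : {X : Set} {_⊏_ : Rel X 0ℓ} →
      WellFounded _⊏_ → Trichotomous _≡_ _⊏_ → (∀ x → Countable (_⊏ x)) →
      U {A = X} EmbedsIn ⌊ ω₁ ⌋
    segment-embedding {X} {_⊏_} wf cmp small =
      proj₁ sequence , λ _ _ →
        distinct-injective {_≈_ = _≡_} sym cmp (proj₁ sequence) (proj₂ sequence)
      where
      module _ (x : X) (f : X → ⌊ ω₁ ⌋) (covered : ∀ v → ∃[ y ] (y ⊏ x × f y ≡ v)) where

        index : ⌊ ω₁ ⌋ → X
        index = proj₁ ∘ covered

        index-injective : ∀ {v w} → index v ≡ index w → v ≡ w
        index-injective {v} {w} eq =
          trans (sym (proj₂ (proj₂ (covered v)))) (trans (cong f eq) (proj₂ (proj₂ (covered w))))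

        covered⇒countable : U {A = ⌊ ω₁ ⌋} EmbedsIn ℕ
        covered⇒countable = EmbedsIn-pullback index (λ {v} _ → proj₁ (proj₂ (covered v)))
          (λ _ _ → index-injective) (small x)

      fresh : ∀ x (f : X → ⌊ ω₁ ⌋) → ∃[ v ] (∀ y → y ⊏ x → f y ≢ v)
      fresh x f = dne λ none → large (covered⇒countable x f λ v →
        dne λ ¬y → none (v , λ y y⊏x eq → ¬y (y , y⊏x , eq)))

      sequence : Σ[ f ∈ (X → ⌊ ω₁ ⌋) ] (∀ {y x} → y ⊏ x → f y ≢ f x)
      sequence = greedy wf _≢_ inhabitant fresh

    ≤-countable : ∀ α → Countable (λ ξ → ξ < α ⊎ ξ ≡ α)
    ≤-countable α = insert-countable α (segment-small α)

    -- In the lexicographic order only pairs with first coordinate at most `α` precede `(α , n)`;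
    -- they form a countable union of countable sets.
    ω₁×ℕ-embedding : U {A = ⌊ ω₁ ⌋ × ℕ} EmbedsIn ⌊ ω₁ ⌋
    ω₁×ℕ-embedding =
      segment-embedding (×-wellFounded wellFounded ℕ.<-wellFounded) cmp small
      where
      _⊏_ : Rel (⌊ ω₁ ⌋ × ℕ) 0ℓ
      _⊏_ = ×-Lex _≡_ _<_ ℕ._<_

      cmp : Trichotomous _≡_ _⊏_
      cmp p q with ×-compare sym compare ℕ.<-cmp p q
      ... | tri< p⊏q p≢q q⊏̸p = tri< p⊏q (p≢q ∘ ≡⇒≡×≡) q⊏̸p
      ... | tri≈ p⊏̸q p≡q q⊏̸p = tri≈ p⊏̸q (≡×≡⇒≡ p≡q) q⊏̸p
      ... | tri> p⊏̸q p≢q q⊏p = tri> p⊏̸q (p≢q ∘ ≡⇒≡×≡) q⊏p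

      small : ∀ p → Countable (_⊏ p)
      small (α , n) = EmbedsIn-⊆
        (λ { {β , m} (inj₁ β<α) → β , inj₁ β<α , refl
           ; {β , m} (inj₂ (β≡α , _)) → β , inj₂ β≡α , refl })
        (⋃-countable {P = λ β p → proj₁ p ≡ β} (≤-countable α)
          (λ _ → proj₂ , λ { {_ , _} {_ , _} refl refl refl → refl }))

    -- The smaller coordinate has a number in the countable segment up to the larger one, which
    -- reduces the claim to ω₁ × ℕ. A tag 0 or 1 records which coordinate was taken as the maximum.
    ω₁×ω₁-embedding : U {A = ⌊ ω₁ ⌋ × ⌊ ω₁ ⌋} EmbedsIn ⌊ ω₁ ⌋
    ω₁×ω₁-embedding = EmbedsIn-pullback (λ (α , β) → code (order α β)) _
      (λ { {α , β} {α′ , β′} _ _ → code-inj (order α β) (order α′ β′) })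
      ω₁×ℕ-embedding
      where
      Order : ⌊ ω₁ ⌋ → ⌊ ω₁ ⌋ → Set
      Order α β = (β < α ⊎ β ≡ α) ⊎ (α < β ⊎ α ≡ β)

      order : ∀ α β → Order α β
      order α β with compare α β
      ... | tri< α<β _ _ = inj₂ (inj₁ α<β)
      ... | tri≈ _ α≡β _ = inj₂ (inj₂ α≡β)
      ... | tri> _ _ β<α = inj₁ (inj₁ β<α)

      e : ⌊ ω₁ ⌋ → ⌊ ω₁ ⌋ → ℕ
      e α = proj₁ (≤-countable α)

      -- A pair is coded by its maximum and a natural number.
      code : ∀ {α β} → Order α β → ⌊ ω₁ ⌋ × ℕ
      code {α} {β} (inj₁ _) = α , pair 0 (e α β)
      code {α} {β} (inj₂ _) = β , pair 1 (e β α)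

      split : ∀ {α β : ⌊ ω₁ ⌋} {m n m′ n′} → (α , pair m n) ≡ (β , pair m′ n′) →
        α ≡ β × m ≡ m′ × n ≡ n′
      split {m = m} {n} {m′} {n′} eq =
        cong proj₁ eq , pair-injective {m} {n} {m′} {n′} (cong proj₂ eq)

      code-inj : ∀ {α β α′ β′} (o : Order α β) (o′ : Order α′ β′) →
        code o ≡ code o′ → (α , β) ≡ (α′ , β′)
      code-inj {α} {β} {α′} {β′} (inj₁ p) (inj₁ q) eq
        with refl , _ , n≡ ← split {m = 0} {e α β} {0} {e α′ β′} eq =
        cong (α ,_) (proj₂ (≤-countable α) p q n≡)
      code-inj {α} {β} {α′} {β′} (inj₂ p) (inj₂ q) eq
        with refl , _ , n≡ ← split {m = 1} {e β α} {1} {e β′ α′} eq =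
        cong (_, β) (proj₂ (≤-countable β) p q n≡)
      code-inj {α} {β} {α′} {β′} (inj₁ _) (inj₂ _) eq
        with _ , () , _ ← split {m = 0} {e α β} {1} {e β′ α′} eq
      code-inj {α} {β} {α′} {β′} (inj₂ _) (inj₁ _) eq
        with _ , () , _ ← split {m = 1} {e β α} {0} {e α′ β′} eq

  -- Counting the automorphisms of a perfect model.

  module _ (ω₁ : SuccessorCardinal ℕ) {L : Vocabulary} (𝒜 : Model L) (A↔ω₁ : ∣ 𝒜 ∣ ↔ ⌊ ω₁ ⌋)
    where
    open SuccessorCardinal ω₁ using (_<_; isStrictTotalOrder; wellFounded)
    open IsStrictTotalOrder isStrictTotalOrder using (compare)
    open Automorphism using (to; bijection)

    private
      A : Set
      A = ∣ 𝒜 ∣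

      Aut : Set
      Aut = Automorphism 𝒜

      module A↔ω₁ = Inverse A↔ω₁

    abstract
      A×A-embedding : U {A = A × A} EmbedsIn ⌊ ω₁ ⌋
      A×A-embedding = EmbedsIn-pullback (λ (x , y) → A↔ω₁.to x , A↔ω₁.to y) _
        (λ _ _ eq → cong₂ _,_ (to-inj (cong proj₁ eq)) (to-inj (cong proj₂ eq)))
        (ω₁×ω₁-embedding ω₁)
        where
        to-inj : ∀ {x y} → A↔ω₁.to x ≡ A↔ω₁.to y → x ≡ y
        to-inj = Injection.injective (Inverse⇒Injection A↔ω₁)

    σ-injection : Injection (σ 𝒜) (2^ ⌊ ω₁ ⌋)
    σ-injection = record
      { to        = λ g → indicator (codes g)
      ; cong      = λ {g} {h} eq ξ → indicator-cong {P = codes g} {codes h}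
          (λ (x , p) → x , trans (cong (λ y → code (x , y)) (sym (eq x))) p)
          (λ (x , p) → x , trans (cong (λ y → code (x , y)) (eq x)) p)
      ; injective = λ {g} {h} eq x →
          -- The code of `(x , to g x)` belongs to `codes h`, so it is also the code of some
          -- `(y , to h y)`, and the two pairs agree.
          let y , p = indicator-sound {P = codes h}
                (trans (sym (eq (code (x , to g x)))) (indicator-true {P = codes g} (x , refl)))
              q = code-inj p
          in sym (trans (cong (to h) (sym (cong proj₁ q))) (cong proj₂ q))
      }
      where
      code : A × A → ⌊ ω₁ ⌋
      code = proj₁ A×A-embedding

      code-inj : ∀ {p q} → code p ≡ code q → p ≡ q
      code-inj = proj₂ A×A-embedding tt tt

      codes : Aut → Pred ⌊ ω₁ ⌋ 0ℓ
      codes g ξ = ∃[ x ] code (x , to g x) ≡ ξ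

    -- Pairs serve as names of challenges: `(x , x)` stands for `x` in the domain, and any `(x , y)`
    -- with `y ≢ x` for `x` in the range. Elements of ω₁ that code no pair receive a default
    -- challenge.
    challenge-enumeration : ∃[ s ] (∀ c → ∃[ α ] s α ≡ c)
    challenge-enumeration = (λ α → decode (find α)) , surjective
      where
      code : A × A → ⌊ ω₁ ⌋
      code = proj₁ A×A-embedding

      find : ∀ α → Dec (∃[ p ] code p ≡ α)
      find α = em

      side : ∀ {x y : A} → Dec (x ≡ y) → Side 𝒜
      side (yes _) = domain
      side (no _)  = range

      a₀ : A
      a₀ = A↔ω₁.from (inhabitant ω₁)

      decode : ∀ {α} → Dec (∃[ p ] code p ≡ α) → Challenge 𝒜
      decode (yes ((x , y) , _)) = x , side (em {P = x ≡ y})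
      decode (no _)              = a₀ , domain

      decode-code : ∀ x y (d : Dec (∃[ p ] code p ≡ code (x , y))) →
        decode d ≡ (x , side (em {P = x ≡ y}))
      decode-code x y (yes (p , eq)) with refl ← proj₂ A×A-embedding tt tt eq = refl
      decode-code x y (no none)      = contradiction (_ , refl) none

      side-≡ : ∀ {x : A} (d : Dec (x ≡ x)) → side d ≡ domain
      side-≡ (yes _)  = refl
      side-≡ (no x≢x) = contradiction refl x≢x

      side-≢ : ∀ {x y : A} → y ≢ x → (d : Dec (x ≡ y)) → side d ≡ range
      side-≢ y≢x (yes x≡y) = contradiction (sym x≡y) y≢x
      side-≢ y≢x (no _)    = refl

      surjective : ∀ c → ∃[ α ] decode (find α) ≡ c
      surjective (x , domain) =
        code (x , x) , trans (decode-code x x em) (cong (x ,_) (side-≡ em))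
      surjective (x , range) =
        let β , β≢ = another ω₁ (A↔ω₁.to x)
            y≢x : A↔ω₁.from β ≢ x
            y≢x eq = β≢ (trans (sym (A↔ω₁.strictlyInverseˡ β)) (cong A↔ω₁.to eq))
        in code (x , _) , trans (decode-code x _ em) (cong (x ,_) (side-≢ y≢x em))

    module _ (perfect : Perfect 𝒜 ω₁) where
      private
        τ : Strategy 𝒜 ω₁
        τ = proj₁ perfect

        s : ⌊ ω₁ ⌋ → Challenge 𝒜
        s = proj₁ challenge-enumeration

      choice : Bool → Choice 𝒜
      choice true  = first
      choice false = second

      turns : (⌊ ω₁ ⌋ → Bool) → ⌊ ω₁ ⌋ → Turn 𝒜
      turns f α = s α , choice (f α)

      module _ (f : ⌊ ω₁ ⌋ → Bool) where
        private
          π : ⌊ ω₁ ⌋ → Rel A 0ℓ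
          π = chosen 𝒜 ω₁ τ (turns f)

        option : ∀ α → IsOption 𝒜 (position 𝒜 ω₁ τ (turns f) α) (s α) (π α)
        option α = pick-option 𝒜 (choice (f α)) (proj₂ perfect (turns f) α)

        ascending : ∀ {α β} → α < β → π α ⇒ π β
        ascending {α} {β} α<β p = proj₁ (proj₂ (proj₂ (option β))) (α , α<β , p)

        directed : ∀ α β → ∃[ γ ] (π α ⇒ π γ × π β ⇒ π γ)
        directed α β with compare α β
        ... | tri< α<β _ _  = β , ascending α<β , id
        ... | tri≈ _ refl _ = α , id , id
        ... | tri> _ _ β<α  = α , id , ascending β<α

        meets-limit : ∀ c {α} → Meets 𝒜 c (π α) → Meets 𝒜 c (λ x y → ∃[ β ] π β x y)
        meets-limit (x , domain) (y , p) = y , _ , p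
        meets-limit (y , range)  (x , p) = x , _ , p

        meets : ∀ c → Meets 𝒜 c (λ x y → ∃[ β ] π β x y)
        meets c =
          let α , sα≡c        = proj₂ challenge-enumeration c
              _ , _ , _ , met = option α
          in meets-limit c (subst (λ c → Meets 𝒜 c (π α)) sα≡c met)

        limit-isPartialIso : IsPartialIso 𝒜 (λ x y → ∃[ α ] π α x y)
        limit-isPartialIso =
          ⋃-isPartialIso 𝒜 (inhabitant ω₁) π directed (proj₁ ∘ option)

        limit : Aut
        limit = automorphism 𝒜 limit-isPartialIso
          (λ x → meets (x , domain)) (λ y → meets (y , range))

        chosen-⊆-limit : ∀ α → π α ⇒ graph 𝒜 limit
        chosen-⊆-limit α p = ⊆-automorphism 𝒜 limit-isPartialIso
          (λ x → meets (x , domain)) (λ y → meets (y , range)) (α , p)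

      -- Different choices would place two contradictory maps inside the partial isomorphism `ρ`.
      same-choice : ∀ {ρ r} → IsPartialIso 𝒜 ρ → Contradictory 𝒜 (proj₁ r) (proj₂ r) →
        ∀ b b′ → pick 𝒜 (choice b) r ⇒ ρ → pick 𝒜 (choice b′) r ⇒ ρ → b ≡ b′
      same-choice iso ⊥r true  true  _ _ = refl
      same-choice iso ⊥r false false _ _ = refl
      same-choice iso ⊥r true  false p q = ⊥-elim (⊥r (_ , iso , p , q))
      same-choice iso ⊥r false true  p q = ⊥-elim (⊥r (_ , iso , q , p))

      -- Induction on `α`: agreement below `α` gives ∃ the same history and the same challenge,
      -- hence the same answer, and both chosen maps lie in the common automorphism.
      limit-injective : ∀ f f′ → (∀ x → to (limit f) x ≡ to (limit f′) x) → ∀ α → f α ≡ f′ α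
      limit-injective f f′ eq = WF.All.wfRec wellFounded 0ℓ (λ α → f α ≡ f′ α) agree
        where
        agree : ∀ α → (∀ {β} → β < α → f β ≡ f′ β) → f α ≡ f′ α
        agree α below = same-choice (graph-isPartialIso 𝒜 (limit f))
          (proj₂ (proj₂ (proj₂ perfect (turns f) α))) (f α) (f′ α)
          (chosen-⊆-limit f α)
          (λ p → trans (eq _) (chosen-⊆-limit f′ α
            (subst (λ r → pick 𝒜 (choice (f′ α)) r _ _) same-answer p)))
          where
          same-answer : answer 𝒜 ω₁ τ (turns f) α ≡ answer 𝒜 ω₁ τ (turns f′) α
          same-answer = cong (λ h → τ α h (s α))
            (ext λ β → ext λ β<α → cong (λ b → s β , choice b) (below β<α))

      limit-injection : Injection (2^ ⌊ ω₁ ⌋) (σ 𝒜)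
      limit-injection = record
        { to        = limit
        ; cong      = λ {f} eq x → cong (λ h → to (limit h) x) (ext eq)
        ; injective = λ {f} {f′} → limit-injective f f′
        }

    perfect⇒2^ω₁ : Perfect 𝒜 ω₁ → σ 𝒜 ≈ᶜ 2^ ⌊ ω₁ ⌋
    perfect⇒2^ω₁ perfect = cantor-bernstein σ-injection (limit-injection perfect)

    2^ω₁⇒many : σ 𝒜 ≈ᶜ 2^ ⌊ ω₁ ⌋ → setoid ⌊ ω₁ ⌋ ≺ σ 𝒜
    2^ω₁⇒many e =
      injection singleton-injection (Inverse⇒Injection (≈ᶜ-sym e)) ,
      λ J → cantor (injection (Inverse⇒Injection (≈ᶜ-sym e)) J)

  -- A sequence of distinct automorphisms of length ω₂.

  module _ (ω₁ : SuccessorCardinal ℕ) (ω₂ : SuccessorCardinal ⌊ ω₁ ⌋)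
    {L : Vocabulary} (𝒜 : Model L) (many : setoid ⌊ ω₁ ⌋ ≺ σ 𝒜)
    where
    open Automorphism using (to)
    private
      module ω₂ = SuccessorCardinal ω₂

      A : Set
      A = ∣ 𝒜 ∣

      Aut : Set
      Aut = Automorphism 𝒜

      W : Set
      W = ⌊ ω₂ ⌋

    -- Greedy choice along ω₂: fewer than ω₂ automorphisms have been chosen before `β`, and more
    -- than ω₁ exist, so one differs from all of them.
    distinct-automorphisms : Σ[ g ∈ (W → Aut) ]
      (∀ {α β} → (∀ x → to (g α) x ≡ to (g β) x) → α ≡ β)
    distinct-automorphisms =
      proj₁ sequence , distinct-injective {_≈_ = λ g h → ∀ x → to g x ≡ to h x}
        (λ eq x → sym (eq x)) (IsStrictTotalOrder.compare ω₂.isStrictTotalOrder)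
        (proj₁ sequence) (proj₂ sequence)
      where
      module _ (β : W) (f : W → Aut)
        (covered : ∀ (g : Aut) → ∃[ α ] (α ω₂.< β × (∀ x → to (f α) x ≡ to g x))) where

        Hit : (A → A) → Set
        Hit u = ∃[ α ] (α ω₂.< β × (∀ x → to (f α) x ≡ u x))

        index : ∀ {u} → Dec (Hit u) → ⌊ ω₁ ⌋
        index (yes (α , _)) = proj₁ (ω₂.segment-small β) α
        index (no _)        = inhabitant ω₁

        index-injective : ∀ {u v} (d : Dec (Hit u)) (e : Dec (Hit v)) → Hit u → Hit v →
          index d ≡ index e → ∀ x → u x ≡ v x
        index-injective (no ¬p) _ p _ _ = contradiction p ¬p
        index-injective (yes _) (no ¬q) _ q _ = contradiction q ¬q
        index-injective (yes (α , p , eq)) (yes (α′ , q , eq′)) _ _ i≡ x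
          with refl ← proj₂ (ω₂.segment-small β) p q i≡ = trans (sym (eq x)) (eq′ x)

        -- Going through the underlying functions makes the choice of an index
        -- independent of the representing automorphism.
        covered⇒few : Injection (σ 𝒜) (setoid ⌊ ω₁ ⌋)
        covered⇒few = record
          { to        = λ g → index {to g} em
          ; cong      = λ eq → cong (λ u → index {u} em) (ext eq)
          ; injective = λ {g} {h} → index-injective em em (covered g) (covered h)
          }

      fresh : ∀ β (f : W → Aut) → ∃[ g ] (∀ α → α ω₂.< β → ¬ (∀ x → to (f α) x ≡ to g x))
      fresh β f = dne λ none → proj₂ many (covered⇒few β f λ g →
        dne λ ¬α → none (g , λ α α<β eq → ¬α (α , α<β , eq)))

      sequence : Σ[ g ∈ (W → Aut) ] (∀ {α β} → α ω₂.< β → ¬ (∀ x → to (g α) x ≡ to (g β) x))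
      sequence = greedy ω₂.wellFounded (λ g h → ¬ (∀ x → to g x ≡ to h x))
        (Injection.to (proj₁ many) (inhabitant ω₁)) fresh

  -- Values of the automorphisms on positive sets.

  module _ (ω₁ : SuccessorCardinal ℕ) (ω₂ : SuccessorCardinal ⌊ ω₁ ⌋) (ideal : I⟨ω⟩ ω₁ ω₂)
    {L : Vocabulary} (𝒜 : Model L) (A↔ω₁ : ∣ 𝒜 ∣ ↔ ⌊ ω₁ ⌋)
    (g : ⌊ ω₂ ⌋ → Automorphism 𝒜)
    (g-injective : ∀ {α β} →
      (∀ x → Automorphism.to (g α) x ≡ Automorphism.to (g β) x) → α ≡ β)
    where
    open I⟨ω⟩ ideal
    open IsProperIdeal isProperIdeal
    open Automorphism using (to; bijection)
    private
      module ω₁ = SuccessorCardinal ω₁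
      module A↔ω₁ = Inverse A↔ω₁

      A : Set
      A = ∣ 𝒜 ∣

      W : Set
      W = ⌊ ω₂ ⌋

      Positive : Pred (Pred W 0ℓ) 0ℓ
      Positive X = X ∉ I

    ⋃-∈I : (X : A → Pred W 0ℓ) → (∀ x → X x ∈ I) → ⋃ A X ∈ I
    ⋃-∈I X X∈I = downward
      (λ {γ} (x , γ∈) → A↔ω₁.to x , subst (λ y → X y γ) (sym (A↔ω₁.strictlyInverseʳ x)) γ∈)
      (isComplete (X ∘ A↔ω₁.from) (X∈I ∘ A↔ω₁.from))

    -- `X` is the union of its ω₁ fibres under `v`, and `I` is closed under such unions.
    positive-fibre : ∀ {X} → Positive X → (v : W → A) →
      ∃[ y ] Positive (λ γ → γ ∈ X × v γ ≡ y)
    positive-fibre {X} X⁺ v = dne λ none → X⁺ (downward (λ {γ} γ∈X → v γ , γ∈X , refl)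
      (⋃-∈I (λ y γ → γ ∈ X × v γ ≡ y) (λ y → dne λ fibre⁺ → none (y , fibre⁺))))

    Branching : Pred W 0ℓ → A → Set
    Branching X z = ∃[ y ] ∃[ y′ ] (y ≢ y′ ×
      Positive (λ γ → γ ∈ X × to (g γ) z ≡ y) × Positive (λ γ → γ ∈ X × to (g γ) z ≡ y′))

    branching-point : ∀ {X} → Positive X → ∃[ z ] Branching X z
    branching-point {X} X⁺ = dne λ none → X⁺ (small none)
      where
      module _ (none : ¬ (∃[ z ] Branching X z)) where
        u : A → A
        u z = proj₁ (positive-fibre X⁺ (λ γ → to (g γ) z))

        Off : A → Pred W 0ℓ
        Off z γ = γ ∈ X × to (g γ) z ≢ u z

        off-∈I : ∀ z → Off z ∈ I
        off-∈I z = downward (λ {γ} (γ∈X , ≢u) → to (g γ) z , ≢u , γ∈X , refl)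
          (⋃-∈I (λ y γ → y ≢ u z × (γ ∈ X × to (g γ) z ≡ y)) fibre-∈I)
          where
          fibre-∈I : ∀ y → (λ γ → y ≢ u z × (γ ∈ X × to (g γ) z ≡ y)) ∈ I
          fibre-∈I y with em {P = y ≡ u z}
          ... | yes y≡u = downward (λ (y≢u , _) → contradiction y≡u y≢u) empty
          -- A positive fibre over `y`, next to the one over `u z`, would make `z` a branching
          -- point.
          ... | no y≢u  = dne λ fibre⁺ → none (z , y , u z , y≢u ,
            (λ fibre∈I → fibre⁺ (downward proj₂ fibre∈I)) ,
            proj₂ (positive-fibre X⁺ (λ γ → to (g γ) z)))

        On : Pred W 0ℓ
        On γ = ∀ z → to (g γ) z ≡ u z

        -- The automorphisms are distinct, so at most one of them equals `u` everywhere.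
        on-∈I : On ∈ I
        on-∈I with em {P = ∃[ γ ] On γ}
        ... | no ∄γ         = downward (λ on → ∄γ (_ , on)) empty
        ... | yes (γ , on) = downward
          (λ on′ → g-injective λ z → trans (on z) (sym (on′ z))) (singletons γ)

        small : X ∈ I
        small = downward cover (union (⋃-∈I Off off-∈I) on-∈I)
          where
          cover : X ⊆ (⋃ A Off ∪ On)
          cover {γ} γ∈X with em {P = ∃[ z ] Off z γ}
          ... | yes off = inj₁ off
          ... | no ¬off = inj₂ λ z → dne λ ≢u → ¬off (z , γ∈X , ≢u)

    -- One move of ∃, supported by sets in `K`.

    Fits : Rel A 0ℓ → Pred W 0ℓ → Set
    Fits π X = ∀ {γ} → γ ∈ X → π ⇒ graph 𝒜 (g γ)

    _▻_ : Rel A 0ℓ → A × A → Rel A 0ℓ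
    (π ▻ p) x y = π x y ⊎ (x , y) ≡ p

    ▻-countable : ∀ {π} p → IsCountable 𝒜 π → IsCountable 𝒜 (π ▻ p)
    ▻-countable (x , y) c = EmbedsIn-⊆
      (λ { (z , inj₁ q) → inj₁ (z , q) ; (_ , inj₂ refl) → inj₂ refl })
      (insert-countable x c)

    ▻-fits : ∀ {π X x y} → Fits π X → (∀ {γ} → γ ∈ X → to (g γ) x ≡ y) → Fits (π ▻ (x , y)) X
    ▻-fits fits eq γ∈X (inj₁ p)    = fits γ∈X p
    ▻-fits fits eq γ∈X (inj₂ refl) = eq γ∈X

    -- A range challenge is met through the fibres of the inverse automorphisms. `Meets` is provided
    -- for every larger `ρ` because the answer adds one more pair.
    meet-challenge : ∀ {X} → Positive X → (c : Challenge 𝒜) →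
      ∃[ x ] ∃[ y ] (Positive (λ γ → γ ∈ X × to (g γ) x ≡ y) ×
        (∀ {π ρ} → π ▻ (x , y) ⇒ ρ → Meets 𝒜 c ρ))
    meet-challenge X⁺ (x , domain) =
      let y , fibre⁺ = positive-fibre X⁺ (λ γ → to (g γ) x)
      in x , y , fibre⁺ , λ ⇒ρ → y , ⇒ρ (inj₂ refl)
    meet-challenge X⁺ (y , range) =
      let x , fibre⁺ = positive-fibre X⁺ (λ γ → Inverse.from (bijection (g γ)) y)
      in x , y ,
         (λ fibre∈I → fibre⁺ (downward
           (λ {γ} (γ∈X , eq) → γ∈X , trans (cong (to (g γ)) (sym eq))
             (Inverse.strictlyInverseˡ (bijection (g γ)) y)) fibre∈I)) ,
         λ ⇒ρ → x , ⇒ρ (inj₂ refl)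

    inhabited : ∀ {X} → X ∈ K → ∃[ γ ] γ ∈ X
    inhabited X∈K = dne λ none → proj₁ isDense X∈K (downward (λ γ∈X → none (_ , γ∈X)) empty)

    State : Set₁
    State = Rel A 0ℓ × Pred W 0ℓ

    -- With each of the two maps ∃ records a set in K of indices γ such that g γ
    -- extends the map.
    Reply : Set₁
    Reply = (Rel A 0ℓ × Rel A 0ℓ) × (Choice 𝒜 → Pred W 0ℓ)

    Supported : Rel A 0ℓ → Pred W 0ℓ → Set
    Supported π X = X ∈ K × Fits π X

    -- A positive fibre of `Z` meets the challenge, and a branching point `z` of that fibre supplies
    -- two values; no functional relation takes both at `z`. Density of `K` then shrinks the two
    -- fibres to the new supports.
    branch : ∀ {π Z} c → IsCountable 𝒜 π → Supported π Z →
      Σ[ r ∈ Reply ] (IsLegal 𝒜 π c (proj₁ r) ×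
        (∀ ch → proj₂ r ch ⊆ Z × Supported (pick 𝒜 ch (proj₁ r)) (proj₂ r ch)))
    branch {π} {Z} c countable (Z∈K , fits)
      with x , y , X⁺ , meets ← meet-challenge (proj₁ isDense Z∈K) c
      with z , w , w′ , w≢w′ , w⁺ , w′⁺ ← branching-point X⁺ =
      ((ρ w , ρ w′) , λ { first → support w⁺ ; second → support w′⁺ }) ,
      (is-option w⁺ , is-option w′⁺ , λ (σ , iso , p , q) →
        w≢w′ (IsPartialIso.functional iso (p (inj₂ refl)) (q (inj₂ refl)))) ,
      λ { first → support-⊆ w⁺ , supported w⁺ ; second → support-⊆ w′⁺ , supported w′⁺ }
      where
      ρ : A → Rel A 0ℓ
      ρ v = (π ▻ (x , y)) ▻ (z , v)

      Fibre : A → Pred W 0ℓ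
      Fibre v γ = (γ ∈ Z × to (g γ) x ≡ y) × to (g γ) z ≡ v

      module _ {v : A} (v⁺ : Positive (Fibre v)) where
        support : Pred W 0ℓ
        support = proj₁ (proj₂ isDense (Fibre v) v⁺)

        support-∈K : support ∈ K
        support-∈K = proj₁ (proj₂ (proj₂ isDense (Fibre v) v⁺))

        support-⊆-fibre : support ⊆ Fibre v
        support-⊆-fibre = proj₂ (proj₂ (proj₂ isDense (Fibre v) v⁺))

        support-⊆ : support ⊆ Z
        support-⊆ = proj₁ ∘ proj₁ ∘ support-⊆-fibre

        supported : Supported (ρ v) support
        supported = support-∈K ,
          ▻-fits (▻-fits (fits ∘ support-⊆) (proj₂ ∘ proj₁ ∘ support-⊆-fibre))
            (proj₂ ∘ support-⊆-fibre)

        is-option : IsOption 𝒜 π c (ρ v)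
        is-option =
          -- A set in `K` has a member `γ`, and `ρ v` is a part of the graph of `g γ`.
          restriction 𝒜 (proj₂ supported (proj₂ (inhabited support-∈K)))
            (graph-isPartialIso 𝒜 (g _)) ,
          ▻-countable _ (▻-countable _ countable) ,
          inj₁ ∘ inj₁ ,
          meets inj₁

    -- The strategy by recursion on the moves.

    Past : ⌊ ω₁ ⌋ → Set₁
    Past α = ∀ β → β ω₁.< α → State

    limit-position : ∀ {α} → Past α → Rel A 0ℓ
    limit-position {α} past x y = ∃[ β ] Σ[ β<α ∈ β ω₁.< α ] proj₁ (past β β<α) x y

    -- Proofs of β < α need not be equal, so a past has to be required not to
    -- depend on them.
    Coherent : ∀ {α} → Past α → Set₁
    Coherent {α} past = Σ[ s ∈ (⌊ ω₁ ⌋ → State) ]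
      ((∀ β β<α → past β β<α ≡ s β) ×
       (∀ β → β ω₁.< α → IsCountable 𝒜 (proj₁ (s β)) × uncurry Supported (s β)) ×
       (∀ ξ η → ξ ω₁.< η → η ω₁.< α → proj₂ (s η) ⊆ proj₂ (s ξ)))

    Good : ∀ {α} → Past α → Challenge 𝒜 → Reply → Set₁
    Good past c r = IsLegal 𝒜 (limit-position past) c (proj₁ r) ×
      (∀ ch → (∀ β β<α → proj₂ r ch ⊆ proj₂ (past β β<α)) ×
              Supported (pick 𝒜 ch (proj₁ r)) (proj₂ r ch))

    -- Closedness of `K` gives a lower bound `Z` of all earlier supports, and each `g γ` with `γ` in
    -- `Z` extends the whole limit position. Successor and limit moves are treated alike.
    good-reply : ∀ {α} {past : Past α} → Coherent past → ∀ c → ∃[ r ] Good past c r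
    good-reply {α} {past} (s , past≡s , ok , descending) c =
      map₂ (map₂ λ supported ch →
          (λ β β<α γ∈ → subst (λ st → _ ∈ proj₂ st) (sym (past≡s β β<α))
            (Z⊆ β β<α (proj₁ (supported ch) γ∈))) ,
          proj₂ (supported ch))
        (branch c countable (Z∈K , fits))
      where
      bound : ∃[ Z ] (Z ∈ K × (∀ β → β ω₁.< α → Z ⊆ proj₂ (s β)))
      bound = isClosed α (proj₂ ∘ s) (λ β β<α → proj₁ (proj₂ (ok β β<α))) descending

      Z : Pred W 0ℓ
      Z = proj₁ bound

      Z∈K : Z ∈ K
      Z∈K = proj₁ (proj₂ bound)

      Z⊆ : ∀ β → β ω₁.< α → Z ⊆ proj₂ (s β)
      Z⊆ = proj₂ (proj₂ bound)

      fits : Fits (limit-position past) Z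
      fits γ∈Z (β , β<α , p) = proj₂ (proj₂ (ok β β<α)) (Z⊆ β β<α γ∈Z)
        (subst (λ st → proj₁ st _ _) (past≡s β β<α) p)

      countable : IsCountable 𝒜 (limit-position past)
      countable = EmbedsIn-⊆
        (λ (y , β , β<α , p) →
          β , β<α , y , subst (λ st → proj₁ st _ y) (past≡s β β<α) p)
        (⋃-countable (ω₁.segment-small α) (λ {β} β<α → proj₁ (ok β β<α)))

    History : ⌊ ω₁ ⌋ → Set
    History α = ∀ β → β ω₁.< α → Turn 𝒜

    Plan : ⌊ ω₁ ⌋ → Set₁
    Plan α = History α → Challenge 𝒜 → Reply

    after : (Challenge 𝒜 → Reply) → Turn 𝒜 → State
    after r (c , ch) = pick 𝒜 ch (proj₁ (r c)) , proj₂ (r c) ch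

    -- The game reveals only the turns of ∀, so the supports are recovered by replaying the earlier
    -- plans on initial segments of the history.
    past : ∀ {α} → (∀ {β} → β ω₁.< α → Plan β) → History α → Past α
    past plan t β β<α = after (plan β<α (λ γ γ<β → t γ (<-trans γ<β β<α))) (t β β<α)
      where open IsStrictTotalOrder ω₁.isStrictTotalOrder using () renaming (trans to <-trans)

    -- Goodness is promised only for coherent pasts, which lets the recursion run over arbitrary
    -- histories. Coherence along actual plays is established afterwards.
    plans : Σ[ plan ∈ (∀ α → Plan α) ] (∀ α t c →
      Coherent (past {α} (λ {β} _ → plan β) t) →
      Good (past {α} (λ {β} _ → plan β) t) c (plan α t c))
    plans = wf-choice ω₁.wellFounded Plan
      (λ α plan r → ∀ t c → Coherent (past {α} plan t) → Good (past {α} plan t) c (r t c))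
      (λ α plan → (λ t c → proj₁ (reply (past {α} plan t) c)) ,
                  (λ t c → proj₂ (reply (past {α} plan t) c)))
      where
      reply : ∀ {α} (p : Past α) c → ∃[ r ] (Coherent p → Good p c r)
      reply p c with em {P = Coherent p}
      ... | yes coherent = map₂ (λ good _ → good) (good-reply coherent c)
      ... | no ¬coherent =
        (((λ _ → ∅) , λ _ → ∅) , λ _ → ∅) , λ coherent → contradiction coherent ¬coherent

    perfect : Perfect 𝒜 ω₁
    perfect = (λ α t c → proj₁ (plan α t c)) , λ t α → proj₁ (good t α)
      where
      plan : ∀ α → Plan α
      plan = proj₁ plans

      module _ (t : ⌊ ω₁ ⌋ → Turn 𝒜) where
        state : ⌊ ω₁ ⌋ → State
        state α = after (plan α (λ β _ → t β)) (t α)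

        GoodAt : ⌊ ω₁ ⌋ → Set₁
        GoodAt α = Good {α} (λ β _ → state β) (proj₁ (t α)) (plan α (λ β _ → t β) (proj₁ (t α)))

        good-at : ∀ α → (∀ {β} → β ω₁.< α → GoodAt β) → GoodAt α
        -- Along a play the past computes to `state`, so independence of the proofs of `β < α` is
        -- `refl`; the remaining clauses come from goodness at earlier moves.
        good-at α below = proj₂ plans α (λ β _ → t β) (proj₁ (t α))
          ( state
          , (λ _ _ → refl)
          , (λ β β<α → proj₁ (proj₂ (pick-option 𝒜 (proj₂ (t β)) (proj₁ (below β<α))))
                     , proj₂ (proj₂ (below β<α) (proj₂ (t β))))
          , λ ξ η ξ<η η<α → proj₁ (proj₂ (below η<α) (proj₂ (t η))) ξ ξ<η
          )

        good : ∀ α → GoodAt α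
        good = WF.All.wfRec ω₁.wellFounded _ GoodAt good-at

corollary13 : (∀ {ℓ} → ExcludedMiddle ℓ) →
    (∀ {a b} → Extensionality a b) →
    (ω₁ : SuccessorCardinal ℕ) (ω₂ : SuccessorCardinal ⌊ ω₁ ⌋) →
    I⟨ω⟩ ω₁ ω₂ →
    (L : Vocabulary) (𝒜 : Model L) →
    ∣ 𝒜 ∣ ↔ ⌊ ω₁ ⌋ →
    ((setoid ⌊ ω₁ ⌋ ≺ σ 𝒜) ⇔ (σ 𝒜 ≈ᶜ 2^ ⌊ ω₁ ⌋)) ×
    ((σ 𝒜 ≈ᶜ 2^ ⌊ ω₁ ⌋) ⇔ Perfect 𝒜 ω₁)
corollary13 em ext ω₁ ω₂ ideal L 𝒜 A↔ω₁ =
  mk⇔ (perfect⇒full ∘ many⇒perfect) full⇒many , mk⇔ (many⇒perfect ∘ full⇒many) perfect⇒full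
  where
  many⇒perfect : setoid ⌊ ω₁ ⌋ ≺ σ 𝒜 → Perfect 𝒜 ω₁
  many⇒perfect many =
    let g , g-injective = distinct-automorphisms em ext ω₁ ω₂ 𝒜 many
    in perfect em ext ω₁ ω₂ ideal 𝒜 A↔ω₁ g g-injective

  perfect⇒full : Perfect 𝒜 ω₁ → σ 𝒜 ≈ᶜ 2^ ⌊ ω₁ ⌋
  perfect⇒full = perfect⇒2^ω₁ em ext ω₁ 𝒜 A↔ω₁

  full⇒many : σ 𝒜 ≈ᶜ 2^ ⌊ ω₁ ⌋ → setoid ⌊ ω₁ ⌋ ≺ σ 𝒜
  full⇒many = 2^ω₁⇒many em ext ω₁ 𝒜 A↔ω₁
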